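{- Let $\mathcal O$ be a Prior-LTL ontology and let $\varkappa$ be a Prior-LTL formula. Then the ontology-mediated query $\boldsymbol q=(\mathcal O,\varkappa)$ is $\mathrm{FO}(<)$-rewritable. That is, there is a constant-free $\mathrm{FO}(<)$-formula $\boldsymbol Q(t)$ with a single free variable $t$ such that, for every data instance $\mathcal A$, $\mathrm{ans}(\boldsymbol q,\mathcal A)=\{\ell\in\mathrm{tem}(\mathcal A)\mid \mathfrak S_{\mathcal A}\models\boldsymbol Q(\ell)\}$.
   Context: Fix a countably infinite set of atomic concepts $A_i$, $i<\omega$. A (temporal) interpretation $\mathfrak M$ assigns to every atomic concept $A$ a set $A^{\mathfrak M}\subseteq\mathbb Z$. Prior-LTL formulas are built from atomic concepts using arbitrary Boolean connectives and the unary operators $\Box_F$ (always in the future), $\Box_P$ (always in the past), $\Diamond_F$ (some time in the future), $\Diamond_P$ (some time in the past). The extension $\varkappa^{\mathfrak M}\subseteq\mathbb Z$ of a formula is defined by interpreting the Booleans set-theoretically (negation is complement in $\mathbb Z$) and, with strict semantics, $(\Box_F\varkappa)^{\mathfrak M}=\{n\mid k\in\varkappa^{\mathfrak M}\text{ for all }k>n\}$, $(\Diamond_F\varkappa)^{\mathfrak M}=\{n\mid k\in\varkappa^{\mathfrak M}\text{ for some }k>n\}$, and symmetrically for $\Box_P,\Diamond_P$ with $k<n$. A Prior-LTL ontology $\mathcal O$ is a finite set of Prior-LTL formulas (axioms), interpreted globally: $\mathfrak M$ is a model of $\mathcal O$ if $\alpha^{\mathfrak M}=\mathbb Z$ for all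 $\alpha\in\mathcal O$. A data instance $\mathcal A$ is a finite set of ground atoms $A_i(\ell)$ with $\ell\in\mathbb Z$; $\min\mathcal A$ and $\max\mathcal A$ are the least and greatest integers occurring in it, and it is assumed throughout that $\min\mathcal A=0$ and $\max\mathcal A\ge 1$. Its active domain is $\mathrm{tem}(\mathcal A)=\{n\in\mathbb Z\mid\min\mathcal A\le n\le\max\mathcal A\}$. $\mathfrak M$ is a model of $(\mathcal O,\mathcal A)$ if it is a model of $\mathcal O$ and $\ell\in A^{\mathfrak M}$ for all $A(\ell)\in\mathcal A$. The set of certain answers is $\mathrm{ans}(\boldsymbol q,\mathcal A)=\{\ell\in\mathrm{tem}(\mathcal A)\mid \ell\in\varkappa^{\mathfrak M}\text{ for every model }\mathfrak M\text{ of }(\mathcal O,\mathcal A)\}$. $\mathfrak S_{\mathcal A}$ is the finite first-order structure with domain $\mathrm{tem}(\mathcal A)$ ordered by $<$, in which $\mathfrak S_{\mathcal A}\models A(\ell)$ iff $A(\ell)\in\mathcal A$, for every atomic concept $A$ (viewed as a unary predicate). $\mathrm{FO}(<)$ is first-order logic over the unary predicates $A_i$ and the binary predicate $<$. -}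

module Defs where

open import Data.Empty using (⊥)
open import Data.Fin.Base using (Fin)
open import Data.Integer.Base using (ℤ; _≤_; _<_; 0ℤ; 1ℤ)
open import Data.List.Base using (List)
open import Data.List.Membership.Propositional using () renaming (_∈_ to _∈ˡ_)
open import Data.List.Relation.Unary.All using (All)
open import Data.Nat.Base using (ℕ; suc)
open import Data.Product.Base using (Σ; Σ-syntax; ∃-syntax; _×_; _,_; proj₁)
open import Data.Sum.Base using (_⊎_)
open import Data.Unit.Base using (⊤)
open import Data.Vec.Base using (Vec; []; _∷_; lookup)
open import Level using (0ℓ) renaming (suc to lsuc)
open import Relation.Binary.Core using (Rel)
open import Relation.Binary.PropositionalEquality.Core using (_≡_)
open import Relation.Nullary.Negation.Core using (¬_)
open import Relation.Unary using (Pred; Universal; U; ∅; ∁; _∩_; _∪_; _⇒_; _∈_; _≐_)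

-- The atomic concept A_i is represented by its index i.
AtomicConcept : Set
AtomicConcept = ℕ

infix  9 ¬ᵗ_ □F_ □P_ ◇F_ ◇P_
infixr 8 _∧ᵗ_
infixr 7 _∨ᵗ_
infixr 6 _⇒ᵗ_

-- ⊤, ⊥, ¬, ∧, ∨, ⇒ are functionally complete, so every Boolean connective
-- is available.
data Formula : Set where
  atom           : AtomicConcept → Formula
  ⊤ᵗ ⊥ᵗ          : Formula
  ¬ᵗ_            : Formula → Formula
  _∧ᵗ_ _∨ᵗ_ _⇒ᵗ_ : Formula → Formula → Formula
  □F_ □P_        : Formula → Formula
  ◇F_ ◇P_        : Formula → Formula

Interpretation : Set₁
Interpretation = AtomicConcept → Pred ℤ 0ℓ

⟦_⟧ : Formula → Interpretation → Pred ℤ 0ℓ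
⟦ atom i ⟧ M = M i
⟦ ⊤ᵗ     ⟧ M = U
⟦ ⊥ᵗ     ⟧ M = ∅
⟦ ¬ᵗ κ   ⟧ M = ∁ (⟦ κ ⟧ M)
⟦ κ ∧ᵗ μ ⟧ M = ⟦ κ ⟧ M ∩ ⟦ μ ⟧ M
⟦ κ ∨ᵗ μ ⟧ M = ⟦ κ ⟧ M ∪ ⟦ μ ⟧ M
⟦ κ ⇒ᵗ μ ⟧ M = ⟦ κ ⟧ M ⇒ ⟦ μ ⟧ M
⟦ □F κ   ⟧ M = λ n → ∀ k → n < k → k ∈ ⟦ κ ⟧ M
⟦ □P κ   ⟧ M = λ n → ∀ k → k < n → k ∈ ⟦ κ ⟧ M
⟦ ◇F κ   ⟧ M = λ n → ∃[ k ] (n < k × k ∈ ⟦ κ ⟧ M)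
⟦ ◇P κ   ⟧ M = λ n → ∃[ k ] (k < n × k ∈ ⟦ κ ⟧ M)

Ontology : Set
Ontology = List Formula

_⊨ᴼ_ : Interpretation → Ontology → Set
M ⊨ᴼ O = All (λ α → Universal (⟦ α ⟧ M)) O

-- (i , ℓ) stands for the ground atom A_i(ℓ).
GroundAtom : Set
GroundAtom = AtomicConcept × ℤ

_OccursIn_ : ℤ → List GroundAtom → Set
ℓ OccursIn As = ∃[ i ] (i , ℓ) ∈ˡ As

IsLeast : ℤ → Pred ℤ 0ℓ → Set
IsLeast m P = m ∈ P × (∀ n → n ∈ P → m ≤ n)

IsGreatest : ℤ → Pred ℤ 0ℓ → Set
IsGreatest m P = m ∈ P × (∀ n → n ∈ P → n ≤ m)

record DataInstance : Set where
  field
    atoms        : List GroundAtom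
    min max      : ℤ
    min-least    : IsLeast min (_OccursIn atoms)
    max-greatest : IsGreatest max (_OccursIn atoms)
    min≡0        : min ≡ 0ℤ
    1≤max        : 1ℤ ≤ max

open DataInstance public using (atoms; min; max)

tem : DataInstance → Pred ℤ 0ℓ
tem A n = min A ≤ n × n ≤ max A

_⊨ᴬ_ : Interpretation → DataInstance → Set
M ⊨ᴬ A = All (λ (i , ℓ) → ℓ ∈ M i) (atoms A)

record OMQ : Set where
  constructor _,_
  field
    ontology : Ontology
    query    : Formula

open OMQ public

ans : OMQ → DataInstance → Pred ℤ (lsuc 0ℓ)
ans q A ℓ = ℓ ∈ tem A × (∀ M → M ⊨ᴼ ontology q → M ⊨ᴬ A → ℓ ∈ ⟦ query q ⟧ M)

infix  9 ¬ᶠ_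
infixr 8 _∧ᶠ_
infixr 7 _∨ᶠ_
infixr 6 _⇒ᶠ_
infix  5 ∀ᶠ_ ∃ᶠ_

-- FO n: formulas with free variables among the n de Bruijn indices; a quantifier
-- binds index zero.  Equality is not primitive: over a strict linear order it is
-- definable from <.
data FO (n : ℕ) : Set where
  pred           : AtomicConcept → Fin n → FO n
  less           : Fin n → Fin n → FO n
  ⊤ᶠ ⊥ᶠ          : FO n
  ¬ᶠ_            : FO n → FO n
  _∧ᶠ_ _∨ᶠ_ _⇒ᶠ_ : FO n → FO n → FO n
  ∀ᶠ_ ∃ᶠ_        : FO (suc n) → FO n

record Structure : Set₁ where
  field
    Domain  : Set
    holds   : AtomicConcept → Pred Domain 0ℓ
    precede : Rel Domain 0ℓ

open Structure public

infix 4 _,_⊨_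

_,_⊨_ : ∀ {n} (S : Structure) → Vec (Domain S) n → FO n → Set
S , ρ ⊨ pred i x = holds S i (lookup ρ x)
S , ρ ⊨ less x y = precede S (lookup ρ x) (lookup ρ y)
S , ρ ⊨ ⊤ᶠ       = ⊤
S , ρ ⊨ ⊥ᶠ       = ⊥
S , ρ ⊨ ¬ᶠ φ     = ¬ (S , ρ ⊨ φ)
S , ρ ⊨ φ ∧ᶠ ψ   = (S , ρ ⊨ φ) × (S , ρ ⊨ ψ)
S , ρ ⊨ φ ∨ᶠ ψ   = (S , ρ ⊨ φ) ⊎ (S , ρ ⊨ ψ)
S , ρ ⊨ φ ⇒ᶠ ψ   = (S , ρ ⊨ φ) → (S , ρ ⊨ ψ)
S , ρ ⊨ ∀ᶠ φ     = (d : Domain S) → S , d ∷ ρ ⊨ φ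
S , ρ ⊨ ∃ᶠ φ     = Σ[ d ∈ Domain S ] (S , d ∷ ρ ⊨ φ)

𝔖 : DataInstance → Structure
𝔖 A = record
  { Domain  = Σ ℤ (tem A)
  ; holds   = λ i d → (i , proj₁ d) ∈ˡ atoms A
  ; precede = λ d e → proj₁ d < proj₁ e
  }

FO<-answers : FO 1 → DataInstance → Pred ℤ 0ℓ
FO<-answers Q A ℓ = Σ[ ℓ∈tem ∈ tem A ℓ ] (𝔖 A , (ℓ , ℓ∈tem) ∷ [] ⊨ Q)

FO<-Rewritable : OMQ → Set₁
FO<-Rewritable q = Σ[ Q ∈ FO 1 ] (∀ A → ans q A ≐ FO<-answers Q A)

{-# OPTIONS --safe #-}
module Submission where

-- Describe an interpretation at a cut (just before a point c) by the finite set
-- of subformulas α that hold at all k ≥ c, together with those that hold at some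
-- k < c.  Two models of the ontology with the same description at a cut can be
-- glued there, so a countermodel over the data is the same as a chain of
-- descriptions in which each step across a data point is realised by some model.
-- By translation invariance and excluded middle, the realisable steps form a
-- finite table that does not depend on the data.  Descriptions only grow from
-- left to right, hence change boundedly often, and the existence of such a chain
-- is expressed by guessing the positions of the changes.

open import Defs
open import Axiom.ExcludedMiddle using (ExcludedMiddle)
open import Level using (0ℓ; suc; Lift; lift; lower)

open import Data.Bool.Base using (Bool; true; false; if_then_else_)
open import Data.Empty using (⊥; ⊥-elim)
open import Data.Fin.Base as Fin using (Fin)
open import Data.Fin.Patterns using (0F; 1F)
open import Data.Integer.Base as ℤ using (ℤ; 0ℤ; 1ℤ; _<_; _≤_; +_)
import Data.Integer.Properties as ℤₚ
open import Data.List.Base using (List; []; _∷_; _++_; [_]; length; foldr)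
open import Data.List.Membership.Propositional using () renaming (_∈_ to _∈ˡ_)
open import Data.List.Relation.Unary.All as All using (All; []; _∷_)
import Data.List.Relation.Unary.All.Properties as Allₚ
open import Data.Nat.Base as ℕ using (ℕ; zero; z≤n; s≤s; _≤′_; ≤′-refl; ≤′-step)
import Data.Nat.Properties as ℕₚ
open import Data.Product.Base using (∃; ∃₂; _×_; _,_; proj₁; proj₂)
open import Data.Sum.Base using (_⊎_; inj₁; inj₂; [_,_]′)
open import Data.Sum.Function.Propositional using (_⊎-⇔_)
open import Data.Unit.Base using (tt)
open import Data.Vec.Base using (Vec; []; _∷_; lookup)
import Data.Vec.Properties as Vecₚ
open import Function.Base using (_∘_; id)
open import Function.Bundles using (_⇔_; mk⇔; module Equivalence)
open import Function.Construct.Composition using (_⇔-∘_)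
open import Function.Construct.Identity using (⇔-id)
open import Function.Related.TypeIsomorphisms using (→-cong-⇔; ¬-cong-⇔)
open import Relation.Binary.Definitions using (tri<; tri≈; tri>)
open import Relation.Binary.PropositionalEquality
  using (_≡_; refl; sym; trans; cong; cong₂; subst)
open import Relation.Nullary.Decidable
  using (Dec; yes; no; does; does-⇔; map′; decidable-stable; toSum)
open import Relation.Nullary.Negation using (¬_; contradiction)
open import Relation.Unary using (Pred)

open Equivalence using (to; from)

-- Core formulas and their tests at cuts

data Modality : Set where
  future past : Modality

Cut : Modality → Pred ℤ 0ℓ → Pred ℤ 0ℓ
Cut future X c = ∀ k → c ≤ k → X k
Cut past   X c = ∃ λ k → k < c × X k

-- Under strict semantics, the future of `k` starts at the cut just before `suc k`, while its past
-- ends at the cut just before `k`; in both cases `k` itself is left out.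
edge : Modality → ℤ → ℤ
edge future = ℤ.suc
edge past   = id

infixr 6 _⊃_

-- The past modality is ◇P rather than □P, so that the truth of both kinds of
-- tests at a cut is preserved to the right.
data Core : Set where
  atom  : AtomicConcept → Core
  ⊥ᶜ    : Core
  _⊃_   : Core → Core → Core
  modal : Modality → Core → Core

⟪_⟫ : Core → Interpretation → Pred ℤ 0ℓ
⟪ atom i    ⟫ M   = M i
⟪ ⊥ᶜ        ⟫ M k = ⊥
⟪ φ ⊃ ψ     ⟫ M k = ⟪ φ ⟫ M k → ⟪ ψ ⟫ M k
⟪ modal o φ ⟫ M k = Cut o (⟪ φ ⟫ M) (edge o k)

Test : Set
Test = Modality × Core

passes : Interpretation → ℤ → Test → Set
passes M c (o , φ) = Cut o (⟪ φ ⟫ M) c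

concepts : Core → List AtomicConcept
concepts (atom i)    = [ i ]
concepts ⊥ᶜ          = []
concepts (φ ⊃ ψ)     = concepts φ ++ concepts ψ
concepts (modal o φ) = concepts φ

tests : Core → List Test
tests (atom i)    = []
tests ⊥ᶜ          = []
tests (φ ⊃ ψ)     = tests φ ++ tests ψ
tests (modal o φ) = (o , φ) ∷ tests φ

cut-mono : ∀ o {X c} → Cut o X c → Cut o X (ℤ.suc c)
cut-mono future {c = c} all k c<k = all k (ℤₚ.≤-trans (ℤₚ.i≤suc[i] c) c<k)
cut-mono past   {c = c} (k , k<c , x) = k , ℤₚ.<-≤-trans k<c (ℤₚ.i≤suc[i] c) , x

-- Translation invariance

shift : ℤ → Interpretation → Interpretation
shift s M i k = M i (k ℤ.+ s)

-+-cancel : ∀ k s → (k ℤ.- s) ℤ.+ s ≡ k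
-+-cancel k s = trans (ℤₚ.+-assoc k (ℤ.- s) s)
  (trans (cong (λ z → k ℤ.+ z) (ℤₚ.+-inverseˡ s)) (ℤₚ.+-identityʳ k))

+--cancel : ∀ k s → (k ℤ.+ s) ℤ.- s ≡ k
+--cancel k s = trans (ℤₚ.+-assoc k s (ℤ.- s))
  (trans (cong (λ z → k ℤ.+ z) (ℤₚ.+-inverseʳ s)) (ℤₚ.+-identityʳ k))

cut-shift : ∀ o {X Y : Pred ℤ 0ℓ} s → (∀ k → X k ⇔ Y (k ℤ.+ s)) →
            ∀ c → Cut o X c ⇔ Cut o Y (c ℤ.+ s)
cut-shift future {X} {Y} s X⇔Y c = mk⇔
  (λ all k c+s≤k → subst Y (-+-cancel k s)
    (to (X⇔Y _) (all _ (subst (_≤ k ℤ.- s) (+--cancel c s) (ℤₚ.+-monoˡ-≤ (ℤ.- s) c+s≤k)))))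
  (λ all k c≤k → from (X⇔Y k) (all _ (ℤₚ.+-monoˡ-≤ s c≤k)))
cut-shift past {X} {Y} s X⇔Y c = mk⇔
  (λ (k , k<c , x) → k ℤ.+ s , ℤₚ.+-monoˡ-< s k<c , to (X⇔Y k) x)
  (λ (k , k<c+s , y) →
    k ℤ.- s ,
    subst (k ℤ.- s <_) (+--cancel c s) (ℤₚ.+-monoˡ-< (ℤ.- s) k<c+s) ,
    from (X⇔Y _) (subst Y (sym (-+-cancel k s)) y))

edge-shift : ∀ o k s → edge o k ℤ.+ s ≡ edge o (k ℤ.+ s)
edge-shift future k s = ℤₚ.+-assoc 1ℤ k s
edge-shift past   k s = refl

⟪⟫-shift : ∀ φ s M k → ⟪ φ ⟫ (shift s M) k ⇔ ⟪ φ ⟫ M (k ℤ.+ s)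
⟪⟫-shift (atom i)    s M k = ⇔-id _
⟪⟫-shift ⊥ᶜ          s M k = ⇔-id _
⟪⟫-shift (φ ⊃ ψ)     s M k = →-cong-⇔ (⟪⟫-shift φ s M k) (⟪⟫-shift ψ s M k)
⟪⟫-shift (modal o φ) s M k =
  subst (λ c → Cut o (⟪ φ ⟫ (shift s M)) (edge o k) ⇔ Cut o (⟪ φ ⟫ M) c) (edge-shift o k s)
    (cut-shift o s (⟪⟫-shift φ s M) (edge o k))

-- Gluing two interpretations at a cut

record Glued (n : ℤ) (X A B : Pred ℤ 0ℓ) : Set where
  field
    below : ∀ k → k < n → X k ⇔ A k
    above : ∀ k → n ≤ k → X k ⇔ B k

open Glued

<⊎≤ : ∀ k n → k < n ⊎ n ≤ k
<⊎≤ k n = [ inj₁ , inj₂ ∘ ℤₚ.≮⇒≥ ]′ (toSum (k ℤₚ.<? n))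

-- A past test at `c` sees only points below `n`, where `X` is `A`. A future test also sees the
-- points from `n` on, but what it asks there is exactly the test at `n`, on which `A` and `B`
-- agree.
cut-below : ∀ o {n X A B} → Glued n X A B → Cut o A n ⇔ Cut o B n →
            ∀ c → c ≤ n → Cut o X c ⇔ Cut o A c
cut-below future {n} {X} {A} {B} g A⇔B c c≤n = mk⇔
  (λ all k c≤k → [ (λ k<n → to (below g k k<n) (all k c≤k))
                 , from A⇔B (λ j n≤j → to (above g j n≤j) (all j (ℤₚ.≤-trans c≤n n≤j))) k
                 ]′ (<⊎≤ k n))
  (λ all k c≤k → [ (λ k<n → from (below g k k<n) (all k c≤k))
                 , (λ n≤k → from (above g k n≤k) (to A⇔B (λ j n≤j → all j (ℤₚ.≤-trans c≤n n≤j)) k n≤k))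
                 ]′ (<⊎≤ k n))
cut-below past g A⇔B c c≤n = mk⇔
  (λ (k , k<c , x) → k , k<c , to (below g k (ℤₚ.<-≤-trans k<c c≤n)) x)
  (λ (k , k<c , a) → k , k<c , from (below g k (ℤₚ.<-≤-trans k<c c≤n)) a)

-- Here the past test is the delicate one: a witness below `n` is traded between `A` and `B` by
-- agreement at `n`, possibly moving to another point.
cut-above : ∀ o {n X A B} → Glued n X A B → Cut o A n ⇔ Cut o B n →
            ∀ c → n ≤ c → Cut o X c ⇔ Cut o B c
cut-above future g A⇔B c n≤c = mk⇔
  (λ all k c≤k → to (above g k (ℤₚ.≤-trans n≤c c≤k)) (all k c≤k))
  (λ all k c≤k → from (above g k (ℤₚ.≤-trans n≤c c≤k)) (all k c≤k))
cut-above past {n} {X} {A} {B} g A⇔B c n≤c = mk⇔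
  (λ (k , k<c , x) →
    [ (λ k<n → widen (to A⇔B (k , k<n , to (below g k k<n) x)))
    , (λ n≤k → k , k<c , to (above g k n≤k) x) ]′ (<⊎≤ k n))
  (λ (k , k<c , b) →
    [ (λ k<n → let j , j<n , a = from A⇔B (k , k<n , b)
               in j , ℤₚ.<-≤-trans j<n n≤c , from (below g j j<n) a)
    , (λ n≤k → k , k<c , from (above g k n≤k) b) ]′ (<⊎≤ k n))
  where
  widen : Cut past B n → Cut past B c
  widen (k , k<n , b) = k , ℤₚ.<-≤-trans k<n n≤c , b

edge-below : ∀ o {k n} → k < n → edge o k ≤ n
edge-below future = ℤₚ.i<j⇒suc[i]≤j
edge-below past   = ℤₚ.<⇒≤

edge-above : ∀ o {k n} → n ≤ k → n ≤ edge o k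
edge-above future {k} n≤k = ℤₚ.≤-trans n≤k (ℤₚ.i≤suc[i] k)
edge-above past   n≤k = n≤k

Agree : ℤ → Interpretation → Interpretation → Test → Set
Agree n M₁ M₂ t = passes M₁ n t ⇔ passes M₂ n t

-- Induction on `φ`: the argument of each modality is itself one of the tests, so the agreement
-- needed by `cut-below` and `cut-above` is among the hypotheses.
⟪⟫-glued : ∀ φ n N M₁ M₂ →
           All (λ i → Glued n (N i) (M₁ i) (M₂ i)) (concepts φ) →
           All (Agree n M₁ M₂) (tests φ) →
           Glued n (⟪ φ ⟫ N) (⟪ φ ⟫ M₁) (⟪ φ ⟫ M₂)
⟪⟫-glued (atom i) n N M₁ M₂ (g ∷ []) _ = g
⟪⟫-glued ⊥ᶜ n N M₁ M₂ _ _ = record { below = λ _ _ → ⇔-id _ ; above = λ _ _ → ⇔-id _ }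
⟪⟫-glued (φ ⊃ ψ) n N M₁ M₂ gs as = record
  { below = λ k k<n → →-cong-⇔ (below gφ k k<n) (below gψ k k<n)
  ; above = λ k n≤k → →-cong-⇔ (above gφ k n≤k) (above gψ k n≤k)
  }
  where
  gφ = ⟪⟫-glued φ n N M₁ M₂ (Allₚ.++⁻ˡ (concepts φ) gs) (Allₚ.++⁻ˡ (tests φ) as)
  gψ = ⟪⟫-glued ψ n N M₁ M₂ (Allₚ.++⁻ʳ (concepts φ) gs) (Allₚ.++⁻ʳ (tests φ) as)
⟪⟫-glued (modal o φ) n N M₁ M₂ gs (a ∷ as) = record
  { below = λ k k<n → cut-below o gφ a (edge o k) (edge-below o k<n)
  ; above = λ k n≤k → cut-above o gφ a (edge o k) (edge-above o n≤k)
  }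
  where
  gφ = ⟪⟫-glued φ n N M₁ M₂ gs as

-- This makes gluing iterable: from `n` on, a further model attaches to `N` exactly when it would
-- attach to `M₂`.
passes-glued-above : ∀ φ n N M₁ M₂ →
           All (λ i → Glued n (N i) (M₁ i) (M₂ i)) (concepts φ) →
           All (Agree n M₁ M₂) (tests φ) →
           ∀ c → n ≤ c → All (Agree c N M₂) (tests φ)
passes-glued-above (atom i) n N M₁ M₂ gs as c n≤c = []
passes-glued-above ⊥ᶜ n N M₁ M₂ gs as c n≤c = []
passes-glued-above (φ ⊃ ψ) n N M₁ M₂ gs as c n≤c = Allₚ.++⁺
  (passes-glued-above φ n N M₁ M₂ (Allₚ.++⁻ˡ (concepts φ) gs) (Allₚ.++⁻ˡ (tests φ) as) c n≤c)
  (passes-glued-above ψ n N M₁ M₂ (Allₚ.++⁻ʳ (concepts φ) gs) (Allₚ.++⁻ʳ (tests φ) as) c n≤c)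
passes-glued-above (modal o φ) n N M₁ M₂ gs (a ∷ as) c n≤c =
  cut-above o (⟪⟫-glued φ n N M₁ M₂ gs as) a c n≤c ∷
  passes-glued-above φ n N M₁ M₂ gs as c n≤c

glue : ℤ → Interpretation → Interpretation → Interpretation
glue n M₁ M₂ i k = (k < n × M₁ i k) ⊎ (n ≤ k × M₂ i k)

glue-glued : ∀ n M₁ M₂ i → Glued n (glue n M₁ M₂ i) (M₁ i) (M₂ i)
glue-glued n M₁ M₂ i = record
  { below = λ k k<n → mk⇔
      [ proj₂ , (λ (n≤k , _) → contradiction n≤k (ℤₚ.<⇒≱ k<n)) ]′ (λ m → inj₁ (k<n , m))
  ; above = λ k n≤k → mk⇔
      [ (λ (k<n , _) → contradiction n≤k (ℤₚ.<⇒≱ k<n)) , proj₂ ]′ (λ m → inj₂ (n≤k , m))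
  }

-- Finite disjunctions and a measure on bit vectors

⋁ : ∀ {n} m → (Vec Bool m → FO n) → FO n
⋁ zero      f = f []
⋁ (ℕ.suc m) f = ⋁ m (f ∘ (true ∷_)) ∨ᶠ ⋁ m (f ∘ (false ∷_))

⊨-⋁ : ∀ {n} S (ρ : Vec (Domain S) n) m (f : Vec Bool m → FO n) →
      (S , ρ ⊨ ⋁ m f) ⇔ ∃ λ v → S , ρ ⊨ f v
⊨-⋁ S ρ zero      f = mk⇔ ([] ,_) λ { ([] , p) → p }
⊨-⋁ S ρ (ℕ.suc m) f = mk⇔
  [ (λ p → let v , q = to (⊨-⋁ S ρ m _) p in true ∷ v , q)
  , (λ p → let v , q = to (⊨-⋁ S ρ m _) p in false ∷ v , q) ]′
  λ { (true ∷ v , q) → inj₁ (from (⊨-⋁ S ρ m _) (v , q))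
    ; (false ∷ v , q) → inj₂ (from (⊨-⋁ S ρ m _) (v , q)) }

falses : ∀ {m} → Vec Bool m → ℕ
falses []          = 0
falses (true ∷ v)  = falses v
falses (false ∷ v) = ℕ.suc (falses v)

falses≤length : ∀ {m} (v : Vec Bool m) → falses v ℕ.≤ m
falses≤length []          = z≤n
falses≤length (true ∷ v)  = ℕₚ.m≤n⇒m≤1+n (falses≤length v)
falses≤length (false ∷ v) = s≤s (falses≤length v)

-- The ontology as a single formula

conjunction : Ontology → Formula
conjunction = foldr _∧ᵗ_ ⊤ᵗ

⊨ᴼ⇔conjunction : ∀ M O → M ⊨ᴼ O ⇔ (∀ n → ⟦ conjunction O ⟧ M n)
⊨ᴼ⇔conjunction M []      = mk⇔ _ (λ _ → [])
⊨ᴼ⇔conjunction M (α ∷ O) = mk⇔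
  (λ { (p ∷ ps) n → p n , to (⊨ᴼ⇔conjunction M O) ps n })
  (λ p → (proj₁ ∘ p) ∷ from (⊨ᴼ⇔conjunction M O) (proj₂ ∘ p))

-- Classical translation into core formulas

module _ (em : ExcludedMiddle (suc 0ℓ)) where

  abstract
    dec : {P : Set} → Dec P
    dec {P} = map′ lower lift (em {Lift (suc 0ℓ) P})

  dne : {P : Set} → ¬ ¬ P → P
  dne = decidable-stable dec

  infix 9 ~_

  ~_ : Core → Core
  ~ φ = φ ⊃ ⊥ᶜ

  core : Formula → Core
  core (atom i) = atom i
  core ⊤ᵗ       = ~ ⊥ᶜ
  core ⊥ᵗ       = ⊥ᶜ
  core (¬ᵗ φ)   = ~ core φ
  core (φ ∧ᵗ ψ) = ~ (core φ ⊃ ~ core ψ)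
  core (φ ∨ᵗ ψ) = ~ core φ ⊃ core ψ
  core (φ ⇒ᵗ ψ) = core φ ⊃ core ψ
  core (□F φ)   = modal future (core φ)
  core (□P φ)   = ~ modal past (~ core φ)
  core (◇F φ)   = ~ modal future (~ core φ)
  core (◇P φ)   = modal past (core φ)

  core-correct : ∀ φ M n → ⟪ core φ ⟫ M n ⇔ ⟦ φ ⟧ M n
  core-correct (atom i) M n = ⇔-id _
  core-correct ⊤ᵗ M n = mk⇔ _ (λ _ x → x)
  core-correct ⊥ᵗ M n = ⇔-id _
  core-correct (¬ᵗ φ) M n = ¬-cong-⇔ (core-correct φ M n)
  core-correct (φ ∧ᵗ ψ) M n = mk⇔
    (λ h → dne (λ ¬φ → h λ x _ → ¬φ (to (core-correct φ M n) x)) ,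
           dne (λ ¬ψ → h λ _ y → ¬ψ (to (core-correct ψ M n) y)))
    (λ (x , y) h → h (from (core-correct φ M n) x) (from (core-correct ψ M n) y))
  core-correct (φ ∨ᵗ ψ) M n = mk⇔
    (λ h → [ inj₁ , (λ ¬φ → inj₂ (to (core-correct ψ M n) (h (¬φ ∘ to (core-correct φ M n))))) ]′
             (toSum (dec {⟦ φ ⟧ M n})))
    [ (λ x ¬x → contradiction (from (core-correct φ M n) x) ¬x)
    , (λ y _ → from (core-correct ψ M n) y) ]′
  core-correct (φ ⇒ᵗ ψ) M n = →-cong-⇔ (core-correct φ M n) (core-correct ψ M n)
  core-correct (□F φ) M n = mk⇔
    (λ h k n<k → to (core-correct φ M k) (h k (ℤₚ.i<j⇒suc[i]≤j n<k)))
    (λ h k n<k → from (core-correct φ M k) (h k (ℤₚ.suc[i]≤j⇒i<j n<k)))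
  core-correct (□P φ) M n = mk⇔
    (λ h k k<n → to (core-correct φ M k) (dne (λ ¬x → h (k , k<n , ¬x))))
    (λ h → λ { (k , k<n , ¬x) → ¬x (from (core-correct φ M k) (h k k<n)) })
  core-correct (◇F φ) M n = mk⇔
    (λ h → dne λ ¬e → h λ k n<k x →
      ¬e (k , ℤₚ.suc[i]≤j⇒i<j n<k , to (core-correct φ M k) x))
    (λ (k , n<k , x) h → h k (ℤₚ.i<j⇒suc[i]≤j n<k) (from (core-correct φ M k) x))
  core-correct (◇P φ) M n = mk⇔
    (λ (k , k<n , x) → k , k<n , to (core-correct φ M k) x)
    (λ (k , k<n , x) → k , k<n , from (core-correct φ M k) x)

  -- Truth values as bit vectors and as constant formulas

  bits : {A : Set} → (A → Set) → (xs : List A) → Vec Bool (length xs)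
  bits P []       = []
  bits P (x ∷ xs) = does (dec {P x}) ∷ bits P xs

  bits-cong : {A : Set} {P Q : A → Set} {xs : List A} →
              All (λ x → P x ⇔ Q x) xs → bits P xs ≡ bits Q xs
  bits-cong []       = refl
  bits-cong (e ∷ es) = cong₂ _∷_ (does-⇔ e dec dec) (bits-cong es)

  does-≡⇒⇔ : {P Q : Set} (p : Dec P) (q : Dec Q) → does p ≡ does q → P ⇔ Q
  does-≡⇒⇔ (yes p) (yes q) _ = mk⇔ (λ _ → q) (λ _ → p)
  does-≡⇒⇔ (no ¬p) (no ¬q) _ = mk⇔ (⊥-elim ∘ ¬p) (⊥-elim ∘ ¬q)

  bits-agree : {A : Set} {P Q : A → Set} (xs : List A) →
               bits P xs ≡ bits Q xs → All (λ x → P x ⇔ Q x) xs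
  bits-agree []       _  = []
  bits-agree (x ∷ xs) eq =
    does-≡⇒⇔ dec dec (Vecₚ.∷-injectiveˡ eq) ∷ bits-agree xs (Vecₚ.∷-injectiveʳ eq)

  -- Bits can only switch on, so any change lowers the number of false bits. This bounds how often a
  -- description changes along the time line.
  bits-mono : {A : Set} {P Q : A → Set} (xs : List A) → (∀ x → P x → Q x) →
              bits P xs ≡ bits Q xs ⊎ falses (bits Q xs) ℕ.< falses (bits P xs)
  bits-mono [] P⊆Q = inj₁ refl
  bits-mono {P = P} {Q} (x ∷ xs) P⊆Q with dec {P x} | dec {Q x} | bits-mono xs P⊆Q
  ... | yes p | no ¬q | _       = contradiction (P⊆Q x p) ¬q
  ... | no _  | yes _ | inj₁ eq = inj₂ (s≤s (ℕₚ.≤-reflexive (cong falses (sym eq))))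
  ... | no _  | yes _ | inj₂ lt = inj₂ (ℕₚ.m≤n⇒m≤1+n lt)
  ... | yes _ | yes _ | inj₁ eq = inj₁ (cong (true ∷_) eq)
  ... | yes _ | yes _ | inj₂ lt = inj₂ lt
  ... | no _  | no _  | inj₁ eq = inj₁ (cong (false ∷_) eq)
  ... | no _  | no _  | inj₂ lt = inj₂ (s≤s lt)

  -- A statement that does not depend on the data is decided once and for all and enters the
  -- rewriting as a truth constant. It lives in `Set₁` because it may quantify over interpretations.
  ⌜_⌝ : ∀ {n} → Set₁ → FO n
  ⌜ P ⌝ = if does (em {P}) then ⊤ᶠ else ⊥ᶠ

  ⊨-⌜⌝ : ∀ {n} S (ρ : Vec (Domain S) n) P → (S , ρ ⊨ ⌜ P ⌝) ⇔ P
  ⊨-⌜⌝ S ρ P with em {P}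
  ... | yes p = mk⇔ (λ _ → p) (λ _ → tt)
  ... | no ¬p = mk⇔ ⊥-elim ¬p

  -- Data assert only positive facts: a false bit forbids the atom in the data, while a true bit
  -- imposes nothing, since a model may satisfy more than the data say.
  excluded : ∀ {n} (is : List AtomicConcept) → Vec Bool (length is) → Fin n → FO n
  excluded []       []          x = ⊤ᶠ
  excluded (i ∷ is) (true ∷ a)  x = excluded is a x
  excluded (i ∷ is) (false ∷ a) x = ¬ᶠ pred i x ∧ᶠ excluded is a x

  ⊨-excluded : ∀ {n} S (ρ : Vec (Domain S) n) x P is →
               (S , ρ ⊨ excluded is (bits P is) x) ⇔ All (λ i → holds S i (lookup ρ x) → P i) is
  ⊨-excluded S ρ x P [] = mk⇔ (λ _ → []) _
  ⊨-excluded S ρ x P (i ∷ is) with dec {P i}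
  ... | yes p = mk⇔
    (λ h → (λ _ → p) ∷ to (⊨-excluded S ρ x P is) h)
    (λ { (_ ∷ h) → from (⊨-excluded S ρ x P is) h })
  ... | no ¬p = mk⇔
    (λ (¬h , h) → (⊥-elim ∘ ¬h) ∷ to (⊨-excluded S ρ x P is) h)
    (λ { (h ∷ hs) → ¬p ∘ h , from (⊨-excluded S ρ x P is) hs })

  -- States, letters and the rewriting

  module _ (ω κ : Core) where

    Ts : List Test
    Ts = tests ω ++ tests κ

    Σs : List AtomicConcept
    Σs = concepts ω ++ concepts κ

    -- The first bit of a letter records the truth of κ.
    State Letter : Set
    State  = Vec Bool (length Ts)
    Letter = Vec Bool (ℕ.suc (length Σs))

    state : Interpretation → ℤ → State
    state M c = bits (passes M c) Ts

    letter : Interpretation → ℤ → Letter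
    letter M z = does (dec {⟪ κ ⟫ M z}) ∷ bits (λ i → M i z) Σs

    Model : Interpretation → Set
    Model M = ∀ n → ⟪ ω ⟫ M n

    -- One entry of the finite table of steps. The point `z` is existential, so the entry refers
    -- neither to the data nor to a particular position.
    Realised : State → Letter → State → Set₁
    Realised q a q′ = ∃₂ λ M z →
      Model M × state M z ≡ q × state M (ℤ.suc z) ≡ q′ × letter M z ≡ a

    -- The disjunction of the two orderings says that `x` differs from `t`: a letter making `κ` true
    -- is barred from the queried point, where a countermodel must falsify `κ`.
    compatible : ∀ {n} → Letter → (x t : Fin n) → FO n
    compatible (b ∷ a) x t = (if b then less x t ∨ᶠ less t x else ⊤ᶠ) ∧ᶠ excluded Σs a x

    edgeᶠ : ∀ {n} → State → State → (x t : Fin n) → FO n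
    edgeᶠ q q′ x t = ⋁ _ λ a → compatible a x t ∧ᶠ ⌜ Realised q a q′ ⌝

    hop : ∀ {n} → (x t : Fin n) → (State → FO n) → State → FO n
    hop x t r q = ⋁ _ λ q′ → edgeᶠ q q′ x t ∧ᶠ r q′

    -- reach f x t q: the positions after x admit a run from q.  The fuel f bounds
    -- the number of state changes; falses q is always enough.
    reach : ∀ {n} → ℕ → (x t : Fin n) → State → FO n
    reach zero x t q = ∀ᶠ (less (Fin.suc x) 0F ⇒ᶠ edgeᶠ q q 0F (Fin.suc t))
    reach (ℕ.suc f) x t q =
      reach zero x t q ∨ᶠ
      (∃ᶠ (less (Fin.suc x) 0F
        ∧ᶠ (∀ᶠ (less (Fin.suc (Fin.suc x)) 0F ⇒ᶠ less 0F 1F ⇒ᶠ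
                edgeᶠ q q 0F (Fin.suc (Fin.suc t))))
        ∧ᶠ hop 0F (Fin.suc t) (reach f 0F (Fin.suc t)) q))

    -- Without constants, position 0 is singled out as the point with no predecessor. The
    -- description at the cut before it is guessed freely, because the data impose nothing further
    -- to the left.
    refutable : FO 1
    refutable =
      ∃ᶠ (¬ᶠ (∃ᶠ less 0F 1F)
        ∧ᶠ ⋁ _ (hop 0F 1F
                 (reach (length Ts) 0F 1F)))

    -- Monotonicity, translation and gluing of states

    state-step : ∀ M z → state M z ≡ state M (ℤ.suc z) ⊎
                         falses (state M (ℤ.suc z)) ℕ.< falses (state M z)
    state-step M z = bits-mono Ts (λ (o , φ) → cut-mono o)

    state-shift : ∀ s M z → state (shift s M) z ≡ state M (z ℤ.+ s)
    state-shift s M z =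
      bits-cong (All.universal (λ (o , φ) → cut-shift o s (⟪⟫-shift φ s M) z) Ts)

    letter-shift : ∀ s M z → letter (shift s M) z ≡ letter M (z ℤ.+ s)
    letter-shift s M z =
      cong (_∷ bits (λ i → M i (z ℤ.+ s)) Σs) (does-⇔ (⟪⟫-shift κ s M z) dec dec)

    -- Translating the given model by `z′ - z` carries its step to `z`; being a model is required at
    -- all integers and so survives the translation.
    realised-at : ∀ {q a q′} → Realised q a q′ → ∀ z → ∃ λ M →
                  Model M × state M z ≡ q × state M (ℤ.suc z) ≡ q′ × letter M z ≡ a
    realised-at (M , z′ , model , refl , refl , refl) z =
      shift s M ,
      (λ n → from (⟪⟫-shift ω s M n) (model _)) ,
      trans (state-shift s M z) (cong (state M) z+s≡z′) ,
      trans (state-shift s M (ℤ.suc z))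
        (cong (state M) (trans (ℤₚ.+-assoc 1ℤ z s) (cong ℤ.suc z+s≡z′))) ,
      trans (letter-shift s M z) (cong (letter M) z+s≡z′)
      where
      s = z′ ℤ.- z
      z+s≡z′ : z ℤ.+ s ≡ z′
      z+s≡z′ = trans (ℤₚ.+-comm z s) (-+-cancel z′ z)

    module _ {n : ℤ} {N M₁ M₂ : Interpretation}
             (glued : All (λ i → Glued n (N i) (M₁ i) (M₂ i)) Σs)
             (same : state M₁ n ≡ state M₂ n) where

      private
        agree  = bits-agree Ts same
        agreeω = Allₚ.++⁻ˡ (tests ω) agree
        agreeκ = Allₚ.++⁻ʳ (tests ω) agree
        gluedω = Allₚ.++⁻ˡ (concepts ω) glued
        gluedκ = Allₚ.++⁻ʳ (concepts ω) glued

      glued-model : Model M₁ → Model M₂ → Model N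
      glued-model model₁ model₂ k =
        [ (λ k<n → from (below g k k<n) (model₁ k))
        , (λ n≤k → from (above g k n≤k) (model₂ k)) ]′ (<⊎≤ k n)
        where g = ⟪⟫-glued ω n N M₁ M₂ gluedω agreeω

      glued-query : Glued n (⟪ κ ⟫ N) (⟪ κ ⟫ M₁) (⟪ κ ⟫ M₂)
      glued-query = ⟪⟫-glued κ n N M₁ M₂ gluedκ agreeκ

      glued-state : ∀ c → n ≤ c → state N c ≡ state M₂ c
      glued-state c n≤c = bits-cong (Allₚ.++⁺
        (passes-glued-above ω n N M₁ M₂ gluedω agreeω c n≤c)
        (passes-glued-above κ n N M₁ M₂ gluedκ agreeκ c n≤c))

    -- Meaning of the rewriting over a data instance

    module _ (A : DataInstance) (ℓ : ℤ) where

      m : ℕ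
      m = ℤ.∣ max A ∣

      0≤max : 0ℤ ≤ max A
      0≤max = ℤₚ.≤-trans (ℤ.+≤+ z≤n) (DataInstance.1≤max A)

      position : ∀ {z} → tem A z → ∃ λ i → z ≡ + i × i ℕ.≤ m
      position {z} (min≤z , z≤max)
        with z | subst (_≤ z) (DataInstance.min≡0 A) min≤z
      ... | + i | _ = i , refl , ℤₚ.drop‿+≤+ (subst (+ i ≤_) (sym (ℤₚ.0≤i⇒+∣i∣≡i 0≤max)) z≤max)

      element : ∀ i → i ℕ.≤ m → Domain (𝔖 A)
      element i i≤m =
        + i ,
        subst (_≤ + i) (sym (DataInstance.min≡0 A)) (ℤ.+≤+ z≤n) ,
        subst (+ i ≤_) (ℤₚ.0≤i⇒+∣i∣≡i 0≤max) (ℤ.+≤+ i≤m)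

      Consistent : Interpretation → ℤ → Set
      Consistent M z =
        All (λ i → (i , z) ∈ˡ atoms A → M i z) Σs × (z ≡ ℓ → ¬ ⟪ κ ⟫ M z)

      Step : State → State → ℤ → Set₁
      Step q q′ z = ∃ λ M → Model M × state M z ≡ q × state M (ℤ.suc z) ≡ q′ × Consistent M z

      Env : ℕ → Set
      Env = Vec (Domain (𝔖 A))

      at : ∀ {n} → Env n → Fin n → ℤ
      at ρ x = proj₁ (lookup ρ x)

      ⊨-compatible : ∀ {n} (ρ : Env n) x t → at ρ t ≡ ℓ → ∀ M →
                     (𝔖 A , ρ ⊨ compatible (letter M (at ρ x)) x t) ⇔ Consistent M (at ρ x)
      ⊨-compatible ρ x t refl M with dec {⟪ κ ⟫ M (at ρ x)}
      ... | no ¬k = mk⇔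
        (λ (_ , e) → to (⊨-excluded (𝔖 A) ρ x _ Σs) e , λ _ → ¬k)
        (λ (e , _) → tt , from (⊨-excluded (𝔖 A) ρ x _ Σs) e)
      ... | yes k = mk⇔
        (λ (x≶t , e) → to (⊨-excluded (𝔖 A) ρ x _ Σs) e ,
          λ x≡t _ → [ ℤₚ.<-irrefl x≡t , ℤₚ.<-irrefl (sym x≡t) ]′ x≶t)
        (λ (e , x≢t) → apart x≢t , from (⊨-excluded (𝔖 A) ρ x _ Σs) e)
        where
        apart : (at ρ x ≡ at ρ t → ¬ ⟪ κ ⟫ M (at ρ x)) → at ρ x < at ρ t ⊎ at ρ t < at ρ x
        apart x≢t with ℤₚ.<-cmp (at ρ x) (at ρ t)
        ... | tri< lt _ _ = inj₁ lt
        ... | tri≈ _ eq _ = contradiction k (x≢t eq)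
        ... | tri> _ _ gt = inj₂ gt

      -- From left to right, a table entry realised somewhere is translated to the position of `x`;
      -- from right to left, the letter to choose is read off the model.
      ⊨-edgeᶠ : ∀ {n} (ρ : Env n) x t q q′ → at ρ t ≡ ℓ →
                (𝔖 A , ρ ⊨ edgeᶠ q q′ x t) ⇔ Step q q′ (at ρ x)
      ⊨-edgeᶠ ρ x t q q′ t≡ℓ = mk⇔ ⇒ ⇐ ⇔-∘
        ⊨-⋁ (𝔖 A) ρ _ (λ a → compatible a x t ∧ᶠ ⌜ Realised q a q′ ⌝)
        where
        ⇒ : (∃ λ a → 𝔖 A , ρ ⊨ compatible a x t ∧ᶠ ⌜ Realised q a q′ ⌝) → Step q q′ (at ρ x)
        ⇒ (a , c , r) with realised-at (to (⊨-⌜⌝ (𝔖 A) ρ (Realised q a q′)) r) (at ρ x)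
        ... | M , model , eq , eq′ , refl =
          M , model , eq , eq′ , to (⊨-compatible ρ x t t≡ℓ M) c
        ⇐ : Step q q′ (at ρ x) → ∃ λ a → 𝔖 A , ρ ⊨ compatible a x t ∧ᶠ ⌜ Realised q a q′ ⌝
        ⇐ (M , model , eq , eq′ , c) =
          letter M (at ρ x) ,
          from (⊨-compatible ρ x t t≡ℓ M) c ,
          from (⊨-⌜⌝ (𝔖 A) ρ _) (M , at ρ x , model , eq , eq′ , refl)

      ⊨-hop : ∀ {n} (ρ : Env n) x t r q → at ρ t ≡ ℓ →
              (𝔖 A , ρ ⊨ hop x t r q) ⇔ ∃ λ q′ → Step q q′ (at ρ x) × (𝔖 A , ρ ⊨ r q′)
      ⊨-hop ρ x t r q t≡ℓ =
        mk⇔ (λ (q′ , e , p) → q′ , to (⊨-edgeᶠ ρ x t q q′ t≡ℓ) e , p)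
            (λ (q′ , s , p) → q′ , from (⊨-edgeᶠ ρ x t q q′ t≡ℓ) s , p)
        ⇔-∘ ⊨-⋁ (𝔖 A) ρ _ (λ q′ → edgeᶠ q q′ x t ∧ᶠ r q′)

      Stays : State → ℕ → Set₁
      Stays q i = ∀ j → i ℕ.< j → j ℕ.≤ m → Step q q (+ j)

      Reach : ℕ → State → ℕ → Set₁
      Reach zero      q i = Stays q i
      Reach (ℕ.suc f) q i = Stays q i ⊎ ∃ λ j →
        i ℕ.< j × j ℕ.≤ m × (∀ k → i ℕ.< k → k ℕ.< j → Step q q (+ k)) ×
        ∃ λ q′ → Step q q′ (+ j) × Reach f q′ j

      ⊨-stays : ∀ {n} (ρ : Env n) x t q i → at ρ t ≡ ℓ → at ρ x ≡ + i →
                (𝔖 A , ρ ⊨ reach zero x t q) ⇔ Stays q i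
      ⊨-stays ρ x t q i t≡ℓ x≡i = mk⇔
        (λ h j i<j j≤m → to (⊨-edgeᶠ (element j j≤m ∷ ρ) 0F (Fin.suc t) q q t≡ℓ)
          (h (element j j≤m) (subst (_< + j) (sym x≡i) (ℤ.+<+ i<j))))
        (λ h d x<d → from (⊨-edgeᶠ (d ∷ ρ) 0F (Fin.suc t) q q t≡ℓ)
          (let j , d≡j , j≤m = position (proj₂ d)
               i<j = ℤₚ.drop‿+<+ (subst (_< + j) x≡i (subst (at ρ x <_) d≡j x<d))
           in subst (Step q q) (sym d≡j) (h j i<j j≤m)))

      ⊨-reach : ∀ f {n} (ρ : Env n) x t q i → at ρ t ≡ ℓ → at ρ x ≡ + i →
                (𝔖 A , ρ ⊨ reach f x t q) ⇔ Reach f q i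
      ⊨-reach zero      ρ x t q i t≡ℓ x≡i = ⊨-stays ρ x t q i t≡ℓ x≡i
      ⊨-reach (ℕ.suc f) ρ x t q i t≡ℓ x≡i = ⊨-stays ρ x t q i t≡ℓ x≡i ⊎-⇔ mk⇔
        (λ (d , x<d , loop , next) →
          let j , d≡j , j≤m = position (proj₂ d)
              q′ , s , r = to (⊨-hop (d ∷ ρ) 0F (Fin.suc t) _ q t≡ℓ) next
          in j ,
             ℤₚ.drop‿+<+ (subst (_< + j) x≡i (subst (at ρ x <_) d≡j x<d)) ,
             j≤m ,
             (λ k i<k k<j →
               let c = element k (ℕₚ.≤-trans (ℕₚ.<⇒≤ k<j) j≤m)
               in to (⊨-edgeᶠ (c ∷ d ∷ ρ) 0F (Fin.suc (Fin.suc t)) q q t≡ℓ)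
                 (loop c (subst (_< + k) (sym x≡i) (ℤ.+<+ i<k))
                         (subst (+ k <_) (sym d≡j) (ℤ.+<+ k<j)))) ,
             q′ ,
             subst (Step q q′) d≡j s ,
             to (⊨-reach f (d ∷ ρ) 0F (Fin.suc t) q′ j t≡ℓ d≡j) r)
        (λ (j , i<j , j≤m , loop , q′ , s , r) →
          let d = element j j≤m in
          d ,
          subst (_< + j) (sym x≡i) (ℤ.+<+ i<j) ,
          (λ c x<c c<d →
            let k , c≡k , k≤m = position (proj₂ c)
                i<k = ℤₚ.drop‿+<+ (subst (_< + k) x≡i (subst (at ρ x <_) c≡k x<c))
                k<j = ℤₚ.drop‿+<+ (subst (_< + j) c≡k c<d)
            in from (⊨-edgeᶠ (c ∷ d ∷ ρ) 0F (Fin.suc (Fin.suc t)) q q t≡ℓ)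
                 (subst (Step q q) (sym c≡k) (loop k i<k k<j))) ,
          from (⊨-hop (d ∷ ρ) 0F (Fin.suc t) _ q t≡ℓ)
            (q′ , s , from (⊨-reach f (d ∷ ρ) 0F (Fin.suc t) q′ j t≡ℓ refl) r))

      -- Runs and bounded numbers of changes

      data Run (q : State) (i : ℕ) : Set₁ where
        done : i ≡ m → Run q i
        step : ∀ {q′} → Step q q′ (+ ℕ.suc i) → Run q′ (ℕ.suc i) → Run q i

      run-≤m : ∀ {q i} → Run q i → i ℕ.≤ m
      run-≤m (done refl) = ℕₚ.≤-refl
      run-≤m (step _ r)  = ℕₚ.<⇒≤ (run-≤m r)

      -- The loop is consumed from its right end: once the step at `j` is put on the run, the
      -- self-step just before it takes over as the step into the run.
      loop-run : ∀ {q q′ i j} → ℕ.suc i ≤′ j → (∀ k → i ℕ.< k → k ℕ.< j → Step q q (+ k)) →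
                 Step q q′ (+ j) → Run q′ j → Run q i
      loop-run ≤′-refl     loop s r = step s r
      loop-run (≤′-step {j} i<j) loop s r =
        loop-run i<j (λ k i<k k<j → loop k i<k (ℕₚ.m≤n⇒m≤1+n k<j))
          (loop j (ℕₚ.≤′⇒≤ i<j) ℕₚ.≤-refl) (step s r)

      stays⇒run : ∀ {q i} → i ℕ.≤ m → Stays q i → Run q i
      stays⇒run i≤m stays with ℕₚ.m≤n⇒m<n∨m≡n i≤m
      ... | inj₁ i<m = loop-run (ℕₚ.≤⇒≤′ i<m) (λ k i<k k<m → stays k i<k (ℕₚ.<⇒≤ k<m))
                         (stays m i<m ℕₚ.≤-refl) (done refl)
      ... | inj₂ i≡m = done i≡m

      reach⇒run : ∀ f {q i} → i ℕ.≤ m → Reach f q i → Run q i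
      reach⇒run zero      i≤m stays        = stays⇒run i≤m stays
      reach⇒run (ℕ.suc f) i≤m (inj₁ stays) = stays⇒run i≤m stays
      reach⇒run (ℕ.suc f) i≤m (inj₂ (j , i<j , j≤m , loop , q′ , s , r)) =
        loop-run (ℕₚ.≤⇒≤′ i<j) loop s (reach⇒run f j≤m r)

      stays⇒reach : ∀ f {q i} → Stays q i → Reach f q i
      stays⇒reach zero      = id
      stays⇒reach (ℕ.suc f) = inj₁

      -- The bound `B` is abstract so as to cover both staying up to `m` and looping strictly before
      -- the next change.
      prepend : ∀ {i} (P : ℕ → Set₁) (B : ℕ → Set) → P (ℕ.suc i) →
                (∀ k → ℕ.suc i ℕ.< k → B k → P k) → ∀ k → i ℕ.< k → B k → P k
      prepend P B p ps k i<k b with ℕₚ.m≤n⇒m<n∨m≡n i<k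
      ... | inj₁ lt   = ps k lt b
      ... | inj₂ refl = p

      -- A self-step costs no fuel: it lengthens the initial stretch on which the state is constant.
      reach-loop : ∀ f {q i} → Step q q (+ ℕ.suc i) → Reach f q (ℕ.suc i) → Reach f q i
      reach-loop zero      s stays        = prepend (Step _ _ ∘ +_) (ℕ._≤ m) s stays
      reach-loop (ℕ.suc f) s (inj₁ stays) = inj₁ (prepend (Step _ _ ∘ +_) (ℕ._≤ m) s stays)
      reach-loop (ℕ.suc f) s (inj₂ (j , i<j , j≤m , loop , rest)) =
        inj₂ (j , ℕₚ.<⇒≤ i<j , j≤m , prepend (Step _ _ ∘ +_) (ℕ._< j) s loop , rest)

      step-falses : ∀ {q q′ z} → Step q q′ z → q ≡ q′ ⊎ falses q′ ℕ.< falses q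
      step-falses (M , _ , refl , refl , _) = state-step M _

      -- Fuel is spent only on steps that change the state, and each of these lowers `falses`; with
      -- no fuel left, no change is possible.
      run⇒reach : ∀ f {q i} → Run q i → falses q ℕ.≤ f → Reach f q i
      run⇒reach f (done refl) _ =
        stays⇒reach f (λ j m<j j≤m → contradiction j≤m (ℕₚ.<⇒≱ m<j))
      run⇒reach f (step s r) q≤f with step-falses s | f
      ... | inj₁ refl | _       = reach-loop _ s (run⇒reach _ r q≤f)
      ... | inj₂ lt   | zero    with () ← ℕₚ.<-≤-trans lt q≤f
      -- The change happens at the very next position, so the constant stretch before it is empty.
      ... | inj₂ lt   | ℕ.suc f = inj₂ (_ , ℕₚ.≤-refl , run-≤m r ,
          (λ k i<k k<1+i → contradiction i<k (ℕₚ.<⇒≱ k<1+i)) ,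
          _ , s , run⇒reach f r (ℕₚ.≤-pred (ℕₚ.<-≤-trans lt q≤f)))

      -- Countermodels and runs

      Countermodel : Interpretation → Set
      Countermodel M = Model M × (∀ i → i ℕ.≤ m → Consistent M (+ i))

      -- Built backwards from `m`, with `M` itself realising every step. It starts at the cut before
      -- 1, as position 0 is crossed by the separate `hop` in `refutable`.
      countermodel⇒run : ∀ {M} → Countermodel M → Run (state M 1ℤ) 0
      countermodel⇒run {M} (model , consistent) = go (ℕₚ.≤⇒≤′ z≤n) ℕₚ.≤-refl (done refl)
        where
        go : ∀ {i j} → i ≤′ j → j ℕ.≤ m → Run (state M (+ ℕ.suc j)) j →
             Run (state M (+ ℕ.suc i)) i
        go ≤′-refl           j≤m r = r
        go (≤′-step {j} i≤j) j<m r = go i≤j (ℕₚ.<⇒≤ j<m)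
          (step (M , model , refl , refl , consistent (ℕ.suc j) j<m) r)

      Consistent-cong : ∀ {M N z} → (∀ i → N i z ⇔ M i z) → ⟪ κ ⟫ N z ⇔ ⟪ κ ⟫ M z →
                        Consistent M z → Consistent N z
      Consistent-cong N⇔M κ⇔ (facts , query) =
        All.map (λ {i} h → from (N⇔M i) ∘ h) facts , λ z≡ℓ → query z≡ℓ ∘ to κ⇔

      -- The accumulated model is correct up to `i`. The model realising the next step replaces it
      -- from `suc i` on, which the equality of states at that cut permits.
      run⇒countermodel : ∀ {q i} → Run q i → ∀ M → Model M → state M (+ ℕ.suc i) ≡ q →
                         (∀ j → j ℕ.≤ i → Consistent M (+ j)) → ∃ Countermodel
      run⇒countermodel (done refl) M model _ consistent = M , model , consistent
      run⇒countermodel {i = i} (step (M₂ , model₂ , eq₂ , eq′ , c₂) r) M₁ model₁ eq₁ consistent =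
        run⇒countermodel r N (glued-model glued same model₁ model₂)
          (trans (glued-state glued same (+ ℕ.suc (ℕ.suc i)) (ℤ.+≤+ (ℕₚ.n≤1+n _))) eq′)
          consistentN
        where
        n = + ℕ.suc i
        N = glue n M₁ M₂
        same = trans eq₁ (sym eq₂)
        glued = All.universal (glue-glued n M₁ M₂) Σs
        consistentN : ∀ j → j ℕ.≤ ℕ.suc i → Consistent N (+ j)
        consistentN j j≤1+i with ℕₚ.m≤n⇒m<n∨m≡n j≤1+i
        ... | inj₁ j<1+i = Consistent-cong
          (λ c → below (glue-glued n M₁ M₂ c) (+ j) (ℤ.+<+ j<1+i))
          (below (glued-query glued same) (+ j) (ℤ.+<+ j<1+i))
          (consistent j (ℕₚ.≤-pred j<1+i))
        ... | inj₂ refl = Consistent-cong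
          (λ c → above (glue-glued n M₁ M₂ c) n ℤₚ.≤-refl)
          (above (glued-query glued same) n ℤₚ.≤-refl)
          c₂

      ⊨-refutable : (ℓ∈tem : tem A ℓ) →
                    (𝔖 A , (ℓ , ℓ∈tem) ∷ [] ⊨ refutable) ⇔ ∃ Countermodel
      ⊨-refutable ℓ∈tem = mk⇔ ⇒ ⇐
        where
        ρ : Env 1
        ρ = (ℓ , ℓ∈tem) ∷ []
        R : State → FO 2
        R = reach (length Ts) 0F 1F
        ⇒ : 𝔖 A , ρ ⊨ refutable → ∃ Countermodel
        ⇒ (d , first , h)
          with q , h′ ← to (⊨-⋁ (𝔖 A) (d ∷ ρ) _ (hop 0F 1F R)) h
          with q′ , s , r ← to (⊨-hop (d ∷ ρ) 0F 1F R q refl) h′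
          with position (proj₂ d)
        ... | ℕ.suc i , d≡i , _ = contradiction
                (element 0 z≤n , subst (0ℤ <_) (sym d≡i) (ℤ.+<+ (s≤s z≤n))) first
        ... | zero , d≡0 , _
          -- The model realising the step across position 0 is the seed of the gluing; it also
          -- supplies everything before the data.
          with M , model , eq , eq′ , c ← subst (Step q q′) d≡0 s =
          run⇒countermodel
            (reach⇒run (length Ts) z≤n
              (to (⊨-reach (length Ts) (d ∷ ρ) 0F 1F q′ 0 refl d≡0) r))
            M model eq′ (λ { zero _ → c })
        ⇐ : ∃ Countermodel → 𝔖 A , ρ ⊨ refutable
        ⇐ (M , counter@(model , consistent)) =
          d ,
          (λ (e , e<d) → let _ , e≡j , _ = position (proj₂ e)
                         in contradiction (ℤ.+≤+ z≤n) (ℤₚ.<⇒≱ (subst (_< 0ℤ) e≡j e<d))) ,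
          from (⊨-⋁ (𝔖 A) (d ∷ ρ) _ (hop 0F 1F R)) (state M 0ℤ ,
          from (⊨-hop (d ∷ ρ) 0F 1F R (state M 0ℤ) refl) (state M 1ℤ ,
            (M , model , refl , refl , consistent 0 z≤n) ,
            from (⊨-reach (length Ts) (d ∷ ρ) 0F 1F _ 0 refl refl)
              (run⇒reach (length Ts) (countermodel⇒run counter) (falses≤length (state M 1ℤ)))))
          where d = element 0 z≤n

      -- Atoms of A over concepts foreign to ω and κ are not tracked by letters;
      -- they are made true everywhere.
      saturate : Interpretation → Interpretation
      saturate M i k = i ∈ˡ Σs → M i k

      -- Viewing the saturated interpretation as `M` glued to itself lets the gluing lemmas show
      -- that `ω` and `κ` keep their extensions; the cut 0 is an arbitrary choice.
      saturate-glued : ∀ M → All (λ i → Glued 0ℤ (saturate M i) (M i) (M i)) Σs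
      saturate-glued M = All.tabulate λ i∈Σs → record
        { below = λ k _ → mk⇔ (λ h → h i∈Σs) (λ h _ → h)
        ; above = λ k _ → mk⇔ (λ h → h i∈Σs) (λ h _ → h)
        }

      countermodel : tem A ℓ → (∃ λ M → Model M × M ⊨ᴬ A × ¬ ⟪ κ ⟫ M ℓ) ⇔ ∃ Countermodel
      countermodel ℓ∈tem = mk⇔
        (λ (M , model , M⊨A , ¬κ) → M , model , λ i _ →
          All.tabulate (λ _ → All.lookup M⊨A) , λ { refl → ¬κ })
        (λ (M , model , consistent) →
          saturate M ,
          glued-model (saturate-glued M) refl model model ,
          All.tabulate (λ {(i , z)} iz∈A i∈Σs →
            let j , z≡j , j≤m = position
                  ( proj₂ (DataInstance.min-least A) z (i , iz∈A)
                  , proj₂ (DataInstance.max-greatest A) z (i , iz∈A))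
            in subst (M i) (sym z≡j) (All.lookup (proj₁ (consistent j j≤m)) i∈Σs
                 (subst (λ z → (i , z) ∈ˡ atoms A) z≡j iz∈A))) ,
          let j , ℓ≡j , j≤m = position ℓ∈tem
              g = glued-query (saturate-glued M) refl
              ¬κ = subst (λ z → ¬ ⟪ κ ⟫ M z) (sym ℓ≡j) (proj₂ (consistent j j≤m) (sym ℓ≡j))
          in [ (λ ℓ<0 → ¬κ ∘ to (below g ℓ ℓ<0)) , (λ 0≤ℓ → ¬κ ∘ to (above g ℓ 0≤ℓ)) ]′ (<⊎≤ ℓ 0ℤ))

-- Certain answers as the points that are not refutable

theoremA : ExcludedMiddle (suc 0ℓ) → (O : Ontology) (κ : Formula) → FO<-Rewritable (O , κ)
theoremA em O κ = ¬ᶠ refutable em ω κ′ , λ A → ans⊆ A , ⊆ans A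
  where
  ω  = core em (conjunction O)
  κ′ = core em κ
  ontology⇔ : ∀ M → M ⊨ᴼ O ⇔ Model em ω κ′ M
  ontology⇔ M = mk⇔
    (λ h n → from (core-correct em (conjunction O) M n) (to (⊨ᴼ⇔conjunction M O) h n))
    (λ h → from (⊨ᴼ⇔conjunction M O) (λ n → to (core-correct em (conjunction O) M n) (h n)))
  ans⊆ : ∀ A {ℓ} → ans (O , κ) A ℓ → FO<-answers (¬ᶠ refutable em ω κ′) A ℓ
  ans⊆ A {ℓ} (ℓ∈tem , certain) = ℓ∈tem , λ r →
    let M , model , M⊨A , ¬κ = from (countermodel em ω κ′ A ℓ ℓ∈tem) (to (⊨-refutable em ω κ′ A ℓ ℓ∈tem) r)
    in ¬κ (from (core-correct em κ M ℓ) (certain M (from (ontology⇔ M) model) M⊨A))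
  ⊆ans : ∀ A {ℓ} → FO<-answers (¬ᶠ refutable em ω κ′) A ℓ → ans (O , κ) A ℓ
  ⊆ans A {ℓ} (ℓ∈tem , ¬r) = ℓ∈tem , λ M M⊨O M⊨A → dne em λ ¬κ →
    ¬r (from (⊨-refutable em ω κ′ A ℓ ℓ∈tem) (to (countermodel em ω κ′ A ℓ ℓ∈tem)
      (M , to (ontology⇔ M) M⊨O , M⊨A , ¬κ ∘ to (core-correct em κ M ℓ))))
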